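{- Let $k\ge1$ be an integer and let $P$ be a $k$-polymatroid. (i) If $k$ is odd, then $(-1)^{r(P)}\,T_k(P;x+1,0)=\chi(P;-x)$. (ii) If $k$ is even, then for any $\eta\in\mathbb{C}$ such that $\eta^k=-1$, we have $(-\eta)^{r(P)}\,T_k(P;1+x\eta^{ -1},1-\eta)=\chi(P;-x)$.
   Context: A polymatroid is a pair $P=(E,r)$ with $E$ a finite set and $r:2^E\to\mathbb{Z}$ such that $r(\emptyset)=0$, $r(A)\le r(B)$ whenever $A\subseteq B$, and $r(A)+r(B)\ge r(A\cup B)+r(A\cap B)$ for all $A,B\subseteq E$. It is a $k$-polymatroid if $r(\{e\})\le k$ for all $e\in E$. Write $r(P)=r(E)$. $k$-polymatroid Tutte polynomial: $T_k(P;x,y)=\sum_{A\subseteq E}(x-1)^{r(E)-r(A)}(y-1)^{k|A|-r(A)}$. Characteristic polynomial: $\chi(P;x)=\sum_{A\subseteq E}(-1)^{|A|}x^{r(P)-r(A)}$. -}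

module Defs where

open import Algebra.Bundles using (CommutativeRing)
open import Algebra.Structures using (IsCommutativeRing)
import Algebra.Properties.Semiring.Exp as Exp
import Algebra.Properties.Ring as RingProperties
open import Data.Fin.Base using (Fin)
open import Data.Fin.Subset using (Subset; inside; outside; ⊥; ⊤; _⊆_; _∪_; _∩_; ⁅_⁆)
  renaming (∣_∣ to card)
open import Data.Fin.Subset.Properties using (⊆-max; ⊆-min)
open import Data.Integer.Base as ℤ using (ℤ; 0ℤ)
import Data.Integer.Properties as ℤ
open import Data.List.Base using (List; []; _∷_; map)
open import Data.Nat.Base as ℕ using (ℕ; zero; suc)
import Data.Nat.Properties as ℕ
open import Data.Product.Base using (_×_; _,_; proj₁; proj₂; ∃-syntax)
open import Data.Rational.Base as ℚ using (ℚ; 0ℚ; 1ℚ; ½; ∣_∣)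
import Data.Rational.Properties as ℚ
open import Data.Vec.Base using (_∷_; [])
open import Level using (Level; 0ℓ)
open import Relation.Nullary.Decidable.Core using (dec⇒maybe)
open import Relation.Binary.PropositionalEquality
  using (_≡_; refl; sym; trans; cong; subst)
open import Relation.Binary.Bundles using (Setoid)
open import Relation.Binary.Structures using (IsEquivalence)
import Relation.Binary.Reasoning.Setoid as SetoidReasoning
open import Tactic.RingSolver using (solve-∀)
open import Tactic.RingSolver.Core.AlmostCommutativeRing using (fromCommutativeRing)

private variable
  c ℓ : Level
  n : ℕ

------------------------------------------------------------------------
-- Polymatroids on the ground set E = Fin n, with total rank r(E) = r ⊤

record Polymatroid (n : ℕ) : Set where
  field
    r          : Subset n → ℤ
    r-∅        : r ⊥ ≡ 0ℤ
    monotone   : ∀ A B → A ⊆ B → r A ℤ.≤ r B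
    submodular : ∀ A B → r (A ∪ B) ℤ.+ r (A ∩ B) ℤ.≤ r A ℤ.+ r B

Is_-Polymatroid : ℕ → Polymatroid n → Set
Is k -Polymatroid P = ∀ e → Polymatroid.r P ⁅ e ⁆ ℤ.≤ ℤ.+ k

-- The integers r(E), r(E) - r(A) and k|A| - r(A) are nonnegative (the last one
-- for a k-polymatroid), so as exponents they are represented by their absolute
-- values.

totalRank : Polymatroid n → ℕ
totalRank P = ℤ.∣ Polymatroid.r P ⊤ ∣

corank : Polymatroid n → Subset n → ℕ
corank P A = ℤ.∣ Polymatroid.r P ⊤ ℤ.- Polymatroid.r P A ∣

nullity : ℕ → Polymatroid n → Subset n → ℕ
nullity k P A = ℤ.∣ ℤ.+ (k ℕ.* card A) ℤ.- Polymatroid.r P A ∣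

module _ (P : Polymatroid n) where
  open Polymatroid P

  0≤r : ∀ A → 0ℤ ℤ.≤ r A
  0≤r A = subst (ℤ._≤ r A) r-∅ (monotone ⊥ A (⊆-min A))

  +totalRank : ℤ.+ totalRank P ≡ r ⊤
  +totalRank = ℤ.0≤i⇒+∣i∣≡i (0≤r ⊤)

  +corank : ∀ A → ℤ.+ corank P A ≡ r ⊤ ℤ.- r A
  +corank A = ℤ.0≤i⇒+∣i∣≡i (ℤ.i≤j⇒0≤j-i (monotone A ⊤ (⊆-max A)))

-- The defining formulas of T_k(P;x,y) and χ(P;x), with x and y elements of an
-- arbitrary commutative ring; polynomial rings are among the choices.
module PolymatroidPolynomials (R : CommutativeRing c ℓ) where
  open CommutativeRing R
  open Exp semiring public using (_^_)

  ∑⊆ : (Subset n → Carrier) → Carrier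
  ∑⊆ {zero}  f = f []
  ∑⊆ {suc n} f = ∑⊆ (λ A → f (outside ∷ A)) + ∑⊆ (λ A → f (inside ∷ A))

  T : ℕ → Polymatroid n → Carrier → Carrier → Carrier
  T k P x y = ∑⊆ λ A → (x - 1#) ^ corank P A * (y - 1#) ^ nullity k P A

  χ : Polymatroid n → Carrier → Carrier
  χ P x = ∑⊆ λ A → (- 1#) ^ card A * x ^ corank P A

------------------------------------------------------------------------
-- Univariate polynomials: coefficient lists, constant term first, where
-- trailing zeros are irrelevant because equality is coefficientwise

module Polynomial (R : CommutativeRing c ℓ) where
  private
    module R = CommutativeRing R
    module RP = RingProperties R.ring
  open R using (_≈_; Carrier; 0#; 1#; setoid)

  Poly : Set c
  Poly = List Carrier

  coeff : Poly → ℕ → Carrier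
  coeff []      _       = 0#
  coeff (a ∷ p) zero    = a
  coeff (a ∷ p) (suc i) = coeff p i

  infix 4 _≋_
  record _≋_ (p q : Poly) : Set ℓ where
    constructor mk≋
    field at : ∀ i → coeff p i ≈ coeff q i
  open _≋_ public

  infixl 6 _⊕_
  _⊕_ : Poly → Poly → Poly
  []      ⊕ q       = q
  (a ∷ p) ⊕ []      = a ∷ p
  (a ∷ p) ⊕ (b ∷ q) = (a R.+ b) ∷ (p ⊕ q)

  infixr 7 _·_
  _·_ : Carrier → Poly → Poly
  a · p = map (a R.*_) p

  ⊖_ : Poly → Poly
  ⊖ p = map R.-_ p

  infixl 7 _⊛_
  _⊛_ : Poly → Poly → Poly
  []      ⊛ q = []
  (a ∷ p) ⊛ q = a · q ⊕ (0# ∷ p ⊛ q)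

  const : Carrier → Poly
  const a = a ∷ []

  X : Poly
  X = 0# ∷ 1# ∷ []

  private
    coeff-⊕ : ∀ p q i → coeff (p ⊕ q) i ≈ coeff p i R.+ coeff q i
    coeff-⊕ []      q       i       = R.sym (R.+-identityˡ _)
    coeff-⊕ (a ∷ p) []      i       = R.sym (R.+-identityʳ _)
    coeff-⊕ (a ∷ p) (b ∷ q) zero    = R.refl
    coeff-⊕ (a ∷ p) (b ∷ q) (suc i) = coeff-⊕ p q i

    coeff-· : ∀ a p i → coeff (a · p) i ≈ a R.* coeff p i
    coeff-· a []      i       = R.sym (R.zeroʳ a)
    coeff-· a (b ∷ p) zero    = R.refl
    coeff-· a (b ∷ p) (suc i) = coeff-· a p i

    coeff-⊖ : ∀ p i → coeff (⊖ p) i ≈ R.- coeff p i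
    coeff-⊖ []      i       = R.sym RP.-0#≈0#
    coeff-⊖ (b ∷ p) zero    = R.refl
    coeff-⊖ (b ∷ p) (suc i) = coeff-⊖ p i

    ≋-isEquivalence : IsEquivalence _≋_
    ≋-isEquivalence = record
      { refl  = mk≋ λ _ → R.refl
      ; sym   = λ e → mk≋ λ i → R.sym (at e i)
      ; trans = λ e f → mk≋ λ i → R.trans (at e i) (at f i)
      }
    open IsEquivalence ≋-isEquivalence renaming (refl to ≋-refl; sym to ≋-sym; trans to ≋-trans)

    ≋-setoid : Setoid c ℓ
    ≋-setoid = record { isEquivalence = ≋-isEquivalence }
    open SetoidReasoning ≋-setoid

    ∷-cong : ∀ {a b p q} → a ≈ b → p ≋ q → a ∷ p ≋ b ∷ q
    ∷-cong e f = mk≋ λ { zero → e ; (suc i) → at f i }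

    0∷[] : 0# ∷ [] ≋ []
    0∷[] = mk≋ λ { zero → R.refl ; (suc i) → R.refl }

    ⊕-cong : ∀ {p q s t} → p ≋ q → s ≋ t → p ⊕ s ≋ q ⊕ t
    ⊕-cong {p} {q} {s} {t} e f = mk≋ λ i →
      R.trans (coeff-⊕ p s i) (R.trans (R.+-cong (at e i) (at f i)) (R.sym (coeff-⊕ q t i)))

    ⊕-assoc : ∀ p q s → (p ⊕ q) ⊕ s ≋ p ⊕ (q ⊕ s)
    ⊕-assoc p q s = mk≋ λ i →
      R.trans (coeff-⊕ (p ⊕ q) s i) (R.trans (R.+-congʳ (coeff-⊕ p q i)) (R.trans (R.+-assoc _ _ _)
        (R.sym (R.trans (coeff-⊕ p (q ⊕ s) i) (R.+-congˡ (coeff-⊕ q s i))))))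

    ⊕-comm : ∀ p q → p ⊕ q ≋ q ⊕ p
    ⊕-comm p q = mk≋ λ i →
      R.trans (coeff-⊕ p q i) (R.trans (R.+-comm _ _) (R.sym (coeff-⊕ q p i)))

    ⊕-identityʳ : ∀ p → p ⊕ [] ≋ p
    ⊕-identityʳ p = ⊕-comm p []

    ⊖-cong : ∀ {p q} → p ≋ q → ⊖ p ≋ ⊖ q
    ⊖-cong {p} {q} e = mk≋ λ i →
      R.trans (coeff-⊖ p i) (R.trans (R.-‿cong (at e i)) (R.sym (coeff-⊖ q i)))

    ⊖-inverseˡ : ∀ p → ⊖ p ⊕ p ≋ []
    ⊖-inverseˡ p = mk≋ λ i →
      R.trans (coeff-⊕ (⊖ p) p i) (R.trans (R.+-congʳ (coeff-⊖ p i)) (R.-‿inverseˡ _))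

    ⊕-interchange : ∀ p q s t → (p ⊕ q) ⊕ (s ⊕ t) ≋ (p ⊕ s) ⊕ (q ⊕ t)
    ⊕-interchange p q s t = begin
      (p ⊕ q) ⊕ (s ⊕ t) ≈⟨ ⊕-assoc p q (s ⊕ t) ⟩
      p ⊕ (q ⊕ (s ⊕ t)) ≈⟨ ⊕-cong (≋-refl {p}) (⊕-assoc q s t) ⟨
      p ⊕ ((q ⊕ s) ⊕ t) ≈⟨ ⊕-cong (≋-refl {p}) (⊕-cong (⊕-comm q s) (≋-refl {t})) ⟩
      p ⊕ ((s ⊕ q) ⊕ t) ≈⟨ ⊕-cong (≋-refl {p}) (⊕-assoc s q t) ⟩
      p ⊕ (s ⊕ (q ⊕ t)) ≈⟨ ⊕-assoc p s (q ⊕ t) ⟨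
      (p ⊕ s) ⊕ (q ⊕ t) ∎

    ·-cong : ∀ {a b p q} → a ≈ b → p ≋ q → a · p ≋ b · q
    ·-cong {a} {b} {p} {q} e f = mk≋ λ i →
      R.trans (coeff-· a p i) (R.trans (R.*-cong e (at f i)) (R.sym (coeff-· b q i)))

    ·-distribˡ-⊕ : ∀ a p q → a · (p ⊕ q) ≋ a · p ⊕ a · q
    ·-distribˡ-⊕ a p q = mk≋ λ i →
      R.trans (coeff-· a (p ⊕ q) i) (R.trans (R.*-congˡ (coeff-⊕ p q i)) (R.trans (R.distribˡ _ _ _)
        (R.sym (R.trans (coeff-⊕ (a · p) (a · q) i) (R.+-cong (coeff-· a p i) (coeff-· a q i))))))

    ·-assoc : ∀ a b p → (a R.* b) · p ≋ a · (b · p)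
    ·-assoc a b p = mk≋ λ i →
      R.trans (coeff-· (a R.* b) p i) (R.trans (R.*-assoc _ _ _)
        (R.sym (R.trans (coeff-· a (b · p) i) (R.*-congˡ (coeff-· b p i)))))

    ·-identity : ∀ p → 1# · p ≋ p
    ·-identity p = mk≋ λ i → R.trans (coeff-· 1# p i) (R.*-identityˡ _)

    ·-zero : ∀ p → 0# · p ≋ []
    ·-zero p = mk≋ λ i → R.trans (coeff-· 0# p i) (R.zeroˡ _)

    ⊛-congˡ : ∀ p {q s} → q ≋ s → p ⊛ q ≋ p ⊛ s
    ⊛-congˡ []      e = ≋-refl
    ⊛-congˡ (a ∷ p) e = ⊕-cong (·-cong R.refl e) (∷-cong R.refl (⊛-congˡ p e))

    ⊛-[] : ∀ p → p ⊛ [] ≋ []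
    ⊛-[] []      = ≋-refl
    ⊛-[] (a ∷ p) = ≋-trans (∷-cong R.refl (⊛-[] p)) 0∷[]

    ⊛-∷ : ∀ p b q → p ⊛ (b ∷ q) ≋ b · p ⊕ (0# ∷ p ⊛ q)
    ⊛-∷ []      b q = ≋-sym 0∷[]
    ⊛-∷ (a ∷ p) b q = ∷-cong (R.+-congʳ (R.*-comm a b)) (begin
      a · q ⊕ p ⊛ (b ∷ q)            ≈⟨ ⊕-cong (≋-refl {a · q}) (⊛-∷ p b q) ⟩
      a · q ⊕ (b · p ⊕ (0# ∷ p ⊛ q)) ≈⟨ ⊕-assoc (a · q) (b · p) _ ⟨
      (a · q ⊕ b · p) ⊕ (0# ∷ p ⊛ q) ≈⟨ ⊕-cong (⊕-comm (a · q) (b · p)) ≋-refl ⟩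
      (b · p ⊕ a · q) ⊕ (0# ∷ p ⊛ q) ≈⟨ ⊕-assoc (b · p) (a · q) _ ⟩
      b · p ⊕ (a · q ⊕ (0# ∷ p ⊛ q)) ∎)

    ⊛-comm : ∀ p q → p ⊛ q ≋ q ⊛ p
    ⊛-comm []      q = ≋-sym (⊛-[] q)
    ⊛-comm (a ∷ p) q = begin
      a · q ⊕ (0# ∷ p ⊛ q) ≈⟨ ⊕-cong (≋-refl {a · q}) (∷-cong R.refl (⊛-comm p q)) ⟩
      a · q ⊕ (0# ∷ q ⊛ p) ≈⟨ ⊛-∷ q a p ⟨
      q ⊛ (a ∷ p)          ∎

    ⊛-cong : ∀ {p q s t} → p ≋ q → s ≋ t → p ⊛ s ≋ q ⊛ t
    ⊛-cong {p} {q} {s} {t} e f = begin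
      p ⊛ s ≈⟨ ⊛-congˡ p f ⟩
      p ⊛ t ≈⟨ ⊛-comm p t ⟩
      t ⊛ p ≈⟨ ⊛-congˡ t e ⟩
      t ⊛ q ≈⟨ ⊛-comm t q ⟩
      q ⊛ t ∎

    ⊛-distribˡ : ∀ p q s → p ⊛ (q ⊕ s) ≋ p ⊛ q ⊕ p ⊛ s
    ⊛-distribˡ []      q s = ≋-refl
    ⊛-distribˡ (a ∷ p) q s = begin
      a · (q ⊕ s) ⊕ (0# ∷ p ⊛ (q ⊕ s))
        ≈⟨ ⊕-cong (·-distribˡ-⊕ a q s) (∷-cong (R.sym (R.+-identityˡ 0#)) (⊛-distribˡ p q s)) ⟩
      (a · q ⊕ a · s) ⊕ ((0# ∷ p ⊛ q) ⊕ (0# ∷ p ⊛ s))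
        ≈⟨ ⊕-interchange (a · q) (a · s) _ _ ⟩
      (a · q ⊕ (0# ∷ p ⊛ q)) ⊕ (a · s ⊕ (0# ∷ p ⊛ s)) ∎

    ⊛-distribʳ : ∀ p q s → (q ⊕ s) ⊛ p ≋ q ⊛ p ⊕ s ⊛ p
    ⊛-distribʳ p q s = begin
      (q ⊕ s) ⊛ p   ≈⟨ ⊛-comm (q ⊕ s) p ⟩
      p ⊛ (q ⊕ s)   ≈⟨ ⊛-distribˡ p q s ⟩
      p ⊛ q ⊕ p ⊛ s ≈⟨ ⊕-cong (⊛-comm p q) (⊛-comm p s) ⟩
      q ⊛ p ⊕ s ⊛ p ∎

    ·-⊛ : ∀ a p q → (a · p) ⊛ q ≋ a · (p ⊛ q)
    ·-⊛ a []      q = ≋-refl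
    ·-⊛ a (b ∷ p) q = begin
      (a R.* b) · q ⊕ (0# ∷ (a · p) ⊛ q)
        ≈⟨ ⊕-cong (·-assoc a b q) (∷-cong (R.sym (R.zeroʳ a)) (·-⊛ a p q)) ⟩
      a · (b · q) ⊕ a · (0# ∷ p ⊛ q)     ≈⟨ ·-distribˡ-⊕ a (b · q) _ ⟨
      a · (b · q ⊕ (0# ∷ p ⊛ q))         ∎

    ⊛-assoc : ∀ p q s → (p ⊛ q) ⊛ s ≋ p ⊛ (q ⊛ s)
    ⊛-assoc []      q s = ≋-refl
    ⊛-assoc (a ∷ p) q s = begin
      (a · q ⊕ (0# ∷ p ⊛ q)) ⊛ s
        ≈⟨ ⊛-distribʳ s (a · q) _ ⟩
      (a · q) ⊛ s ⊕ (0# · s ⊕ (0# ∷ (p ⊛ q) ⊛ s))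
        ≈⟨ ⊕-cong (·-⊛ a q s) (⊕-cong (·-zero s) (∷-cong R.refl (⊛-assoc p q s))) ⟩
      a · (q ⊛ s) ⊕ (0# ∷ p ⊛ (q ⊛ s)) ∎

    ⊛-identityˡ : ∀ p → const 1# ⊛ p ≋ p
    ⊛-identityˡ p = begin
      1# · p ⊕ (0# ∷ []) ≈⟨ ⊕-cong (·-identity p) 0∷[] ⟩
      p ⊕ []             ≈⟨ ⊕-identityʳ p ⟩
      p                  ∎

    isCommutativeRing : IsCommutativeRing _≋_ _⊕_ _⊛_ ⊖_ [] (const 1#)
    isCommutativeRing = record
      { isRing = record
        { +-isAbelianGroup = record
          { isGroup = record
            { isMonoid = record
              { isSemigroup = record
                { isMagma = record { isEquivalence = ≋-isEquivalence ; ∙-cong = ⊕-cong }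
                ; assoc   = ⊕-assoc
                }
              ; identity = (λ _ → ≋-refl) , ⊕-identityʳ
              }
            ; inverse = ⊖-inverseˡ , λ p → ≋-trans (⊕-comm p (⊖ p)) (⊖-inverseˡ p)
            ; ⁻¹-cong = ⊖-cong
            }
          ; comm = ⊕-comm
          }
        ; *-cong     = ⊛-cong
        ; *-assoc    = ⊛-assoc
        ; *-identity = ⊛-identityˡ , λ p → ≋-trans (⊛-comm p _) (⊛-identityˡ p)
        ; distrib    = ⊛-distribˡ , ⊛-distribʳ
        }
      ; *-comm = ⊛-comm
      }

  polynomialRing : CommutativeRing c ℓ
  polynomialRing = record { isCommutativeRing = isCommutativeRing }

------------------------------------------------------------------------
-- Real numbers: rational Cauchy sequences modulo null sequences

-- s m n becomes arbitrarily small once both indices are large.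
Vanishing : (ℕ → ℕ → ℚ) → Set
Vanishing s = ∀ ε → 0ℚ ℚ.< ε →
  ∃[ N ] (∀ m n → N ℕ.≤ m → N ℕ.≤ n → ∣ s m n ∣ ℚ.< ε)

record ℝ : Set where
  no-eta-equality
  field
    seq    : ℕ → ℚ
    cauchy : Vanishing λ m n → seq m ℚ.- seq n
open ℝ public

infix 4 _≃_
record _≃_ (x y : ℝ) : Set where
  constructor mk≃
  field null : Vanishing λ n _ → seq x n ℚ.- seq y n
open _≃_ public

private
  ℚ-solverRing = fromCommutativeRing ℚ.+-*-commutativeRing (λ q → dec⇒maybe (0ℚ ℚ.≟ q))

module RealNumbers where
  private
    Bounded : (ℕ → ℕ → ℚ) → Set
    Bounded s = ∃[ B ] 0ℚ ℚ.< B × ∃[ N ] (∀ m n → N ℕ.≤ m → N ℕ.≤ n → ∣ s m n ∣ ℚ.≤ B)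

    vanishing-≗ : ∀ {s t} → (∀ m n → s m n ≡ t m n) → Vanishing s → Vanishing t
    vanishing-≗ e v ε ε>0 = let N , h = v ε ε>0 in
      N , λ m n N≤m N≤n → subst (λ q → ∣ q ∣ ℚ.< ε) (e m n) (h m n N≤m N≤n)

    vanishing-0 : Vanishing λ _ _ → 0ℚ
    vanishing-0 ε ε>0 = 0 , λ _ _ _ _ → ε>0

    halves : ∀ ε → ε ℚ.* ½ ℚ.+ ε ℚ.* ½ ≡ ε
    halves ε = trans (sym (ℚ.*-distribˡ-+ ε ½ ½)) (ℚ.*-identityʳ ε)

    half>0 : ∀ {ε} → 0ℚ ℚ.< ε → 0ℚ ℚ.< ε ℚ.* ½
    half>0 {ε} ε>0 = subst (ℚ._< ε ℚ.* ½) (ℚ.*-zeroˡ ½) (ℚ.*-monoˡ-<-pos ½ ε>0)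

    vanishing-+ : ∀ {s t} → Vanishing s → Vanishing t → Vanishing (λ m n → s m n ℚ.+ t m n)
    vanishing-+ {s} {t} v w ε ε>0 =
      let M , h = v (ε ℚ.* ½) (half>0 ε>0)
          N , k = w (ε ℚ.* ½) (half>0 ε>0)
      in M ℕ.⊔ N , λ m n ≤m ≤n → let open ℚ.≤-Reasoning in begin-strict
        ∣ s m n ℚ.+ t m n ∣     ≤⟨ ℚ.∣p+q∣≤∣p∣+∣q∣ (s m n) (t m n) ⟩
        ∣ s m n ∣ ℚ.+ ∣ t m n ∣ <⟨ ℚ.+-mono-<
                                     (h m n (ℕ.m⊔n≤o⇒m≤o M N ≤m) (ℕ.m⊔n≤o⇒m≤o M N ≤n))
                                     (k m n (ℕ.m⊔n≤o⇒n≤o M N ≤m) (ℕ.m⊔n≤o⇒n≤o M N ≤n)) ⟩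
        ε ℚ.* ½ ℚ.+ ε ℚ.* ½     ≡⟨ halves ε ⟩
        ε                       ∎

    vanishing-neg : ∀ {s} → Vanishing s → Vanishing (λ m n → ℚ.- s m n)
    vanishing-neg {s} v ε ε>0 = let N , h = v ε ε>0 in
      N , λ m n N≤m N≤n → subst (ℚ._< ε) (sym (ℚ.∣-p∣≡∣p∣ (s m n))) (h m n N≤m N≤n)

    vanishing-* : ∀ {s t} → Bounded s → Vanishing t → Vanishing (λ m n → s m n ℚ.* t m n)
    vanishing-* {s} {t} (B , B>0 , M , h) w ε ε>0 =
      let N , k = w δ δ>0
      in M ℕ.⊔ N , λ m n ≤m ≤n → let open ℚ.≤-Reasoning in begin-strict
        ∣ s m n ℚ.* t m n ∣     ≡⟨ ℚ.∣p*q∣≡∣p∣*∣q∣ (s m n) (t m n) ⟩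
        ∣ s m n ∣ ℚ.* ∣ t m n ∣ ≤⟨ ℚ.*-monoʳ-≤-nonNeg ∣ t m n ∣
                                     {{ℚ.nonNegative (ℚ.0≤∣p∣ (t m n))}}
                                     (h m n (ℕ.m⊔n≤o⇒m≤o M N ≤m) (ℕ.m⊔n≤o⇒m≤o M N ≤n)) ⟩
        B ℚ.* ∣ t m n ∣         <⟨ ℚ.*-monoʳ-<-pos B
                                     (k m n (ℕ.m⊔n≤o⇒n≤o M N ≤m) (ℕ.m⊔n≤o⇒n≤o M N ≤n)) ⟩
        B ℚ.* δ                 ≡⟨ Bδ≡ε ⟩
        ε                       ∎
      where
      instance
        B-pos : ℚ.Positive B
        B-pos = ℚ.positive B>0
        B≢0 : ℚ.NonZero B
        B≢0 = ℚ.pos⇒nonZero B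
      δ = ℚ.1/ B ℚ.* ε
      Bδ≡ε : B ℚ.* δ ≡ ε
      Bδ≡ε = trans (sym (ℚ.*-assoc B (ℚ.1/ B) ε))
        (trans (cong (ℚ._* ε) (ℚ.*-inverseʳ B)) (ℚ.*-identityˡ ε))
      δ>0 : 0ℚ ℚ.< δ
      δ>0 = ℚ.*-cancelˡ-<-nonNeg B {{ℚ.pos⇒nonNeg B}}
        (let open ℚ.≤-Reasoning in begin-strict
          B ℚ.* 0ℚ ≡⟨ ℚ.*-zeroʳ B ⟩
          0ℚ       <⟨ ε>0 ⟩
          ε        ≡⟨ Bδ≡ε ⟨
          B ℚ.* δ  ∎)

    bounded : ∀ x → Bounded (λ m _ → seq x m)
    bounded x = B , B>0 , N , λ m n N≤m _ → let open ℚ.≤-Reasoning in begin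
        ∣ seq x m ∣                                ≡⟨ cong ∣_∣ (split (seq x m) (seq x N)) ⟩
        ∣ (seq x m ℚ.- seq x N) ℚ.+ seq x N ∣      ≤⟨ ℚ.∣p+q∣≤∣p∣+∣q∣ (seq x m ℚ.- seq x N) (seq x N) ⟩
        ∣ seq x m ℚ.- seq x N ∣ ℚ.+ ∣ seq x N ∣    ≤⟨ ℚ.+-monoˡ-≤ ∣ seq x N ∣
                                                        (ℚ.<⇒≤ (h m N N≤m ℕ.≤-refl)) ⟩
        B                                          ∎
      where
      1>0 : 0ℚ ℚ.< 1ℚ
      1>0 = ℚ.positive⁻¹ 1ℚ
      N = proj₁ (cauchy x 1ℚ 1>0)
      h = proj₂ (cauchy x 1ℚ 1>0)
      B = 1ℚ ℚ.+ ∣ seq x N ∣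
      B>0 : 0ℚ ℚ.< B
      B>0 = ℚ.+-mono-<-≤ 1>0 (ℚ.0≤∣p∣ (seq x N))
      split : ∀ a b → a ≡ (a ℚ.- b) ℚ.+ b
      split = solve-∀ ℚ-solverRing

    bounded-flip : ∀ {s} → Bounded s → Bounded (λ m n → s n m)
    bounded-flip (B , B>0 , N , h) = B , B>0 , N , λ m n N≤m N≤n → h n m N≤n N≤m

    sum-difference : ∀ a b c d → (a ℚ.- c) ℚ.+ (b ℚ.- d) ≡ (a ℚ.+ b) ℚ.- (c ℚ.+ d)
    sum-difference = solve-∀ ℚ-solverRing

    neg-difference : ∀ a b → ℚ.- (a ℚ.- b) ≡ (ℚ.- a) ℚ.- (ℚ.- b)
    neg-difference = solve-∀ ℚ-solverRing

    product-difference : ∀ a b c d →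
      a ℚ.* (b ℚ.- d) ℚ.+ d ℚ.* (a ℚ.- c) ≡ a ℚ.* b ℚ.- c ℚ.* d
    product-difference = solve-∀ ℚ-solverRing

  fromℚ : ℚ → ℝ
  seq    (fromℚ q) n = q
  cauchy (fromℚ q)   = vanishing-≗ (λ _ _ → sym (ℚ.+-inverseʳ q)) vanishing-0

  _+_ : ℝ → ℝ → ℝ
  seq    (x + y) n = seq x n ℚ.+ seq y n
  cauchy (x + y)   =
    vanishing-≗ (λ m n → sum-difference (seq x m) (seq y m) (seq x n) (seq y n))
      (vanishing-+ (cauchy x) (cauchy y))

  _*_ : ℝ → ℝ → ℝ
  seq    (x * y) n = seq x n ℚ.* seq y n
  cauchy (x * y)   =
    vanishing-≗ (λ m n → product-difference (seq x m) (seq y m) (seq x n) (seq y n))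
      (vanishing-+ (vanishing-* (bounded x) (cauchy y))
                   (vanishing-* (bounded-flip (bounded y)) (cauchy x)))

  -_ : ℝ → ℝ
  seq    (- x) n = ℚ.- seq x n
  cauchy (- x)   =
    vanishing-≗ (λ m n → neg-difference (seq x m) (seq x n)) (vanishing-neg (cauchy x))

  pointwise : ∀ {x y} → (∀ n → seq x n ≡ seq y n) → x ≃ y
  pointwise {x} {y} e = mk≃ (vanishing-≗
    (λ n _ → sym (trans (cong (ℚ._- seq y n) (e n)) (ℚ.+-inverseʳ (seq y n)))) vanishing-0)

  private
    ≃-isEquivalence : IsEquivalence _≃_
    ≃-isEquivalence = record
      { refl  = pointwise λ _ → refl
      ; sym   = λ {x} {y} e → mk≃ (vanishing-≗
          (λ n _ → swap (seq x n) (seq y n)) (vanishing-neg (null e)))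
      ; trans = λ {x} {y} {z} e f → mk≃ (vanishing-≗
          (λ n _ → chain (seq x n) (seq y n) (seq z n)) (vanishing-+ (null e) (null f)))
      }
      where
      swap : ∀ a b → ℚ.- (a ℚ.- b) ≡ b ℚ.- a
      swap = solve-∀ ℚ-solverRing
      chain : ∀ a b c → (a ℚ.- b) ℚ.+ (b ℚ.- c) ≡ a ℚ.- c
      chain = solve-∀ ℚ-solverRing

    +-cong : ∀ {x y u v} → x ≃ y → u ≃ v → (x + u) ≃ (y + v)
    +-cong {x} {y} {u} {v} e f = mk≃ (vanishing-≗
      (λ n _ → sum-difference (seq x n) (seq u n) (seq y n) (seq v n))
      (vanishing-+ (null e) (null f)))

    -‿cong : ∀ {x y} → x ≃ y → (- x) ≃ (- y)
    -‿cong {x} {y} e = mk≃ (vanishing-≗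
      (λ n _ → neg-difference (seq x n) (seq y n)) (vanishing-neg (null e)))

    *-cong : ∀ {x y u v} → x ≃ y → u ≃ v → (x * u) ≃ (y * v)
    *-cong {x} {y} {u} {v} e f = mk≃ (vanishing-≗
      (λ n _ → product-difference (seq x n) (seq u n) (seq y n) (seq v n))
      (vanishing-+ (vanishing-* (bounded x) (null f)) (vanishing-* (bounded v) (null e))))

    +-assoc : ∀ x y z → ((x + y) + z) ≃ (x + (y + z))
    +-assoc x y z = pointwise λ n → ℚ.+-assoc (seq x n) (seq y n) (seq z n)

    +-identityˡ : ∀ x → (fromℚ 0ℚ + x) ≃ x
    +-identityˡ x = pointwise λ n → ℚ.+-identityˡ (seq x n)

    +-identityʳ : ∀ x → (x + fromℚ 0ℚ) ≃ x
    +-identityʳ x = pointwise λ n → ℚ.+-identityʳ (seq x n)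

    +-inverseˡ : ∀ x → ((- x) + x) ≃ fromℚ 0ℚ
    +-inverseˡ x = pointwise λ n → ℚ.+-inverseˡ (seq x n)

    +-inverseʳ : ∀ x → (x + (- x)) ≃ fromℚ 0ℚ
    +-inverseʳ x = pointwise λ n → ℚ.+-inverseʳ (seq x n)

    +-comm : ∀ x y → (x + y) ≃ (y + x)
    +-comm x y = pointwise λ n → ℚ.+-comm (seq x n) (seq y n)

    *-assoc : ∀ x y z → ((x * y) * z) ≃ (x * (y * z))
    *-assoc x y z = pointwise λ n → ℚ.*-assoc (seq x n) (seq y n) (seq z n)

    *-identityˡ : ∀ x → (fromℚ 1ℚ * x) ≃ x
    *-identityˡ x = pointwise λ n → ℚ.*-identityˡ (seq x n)

    *-identityʳ : ∀ x → (x * fromℚ 1ℚ) ≃ x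
    *-identityʳ x = pointwise λ n → ℚ.*-identityʳ (seq x n)

    *-distribˡ-+ : ∀ x y z → (x * (y + z)) ≃ ((x * y) + (x * z))
    *-distribˡ-+ x y z = pointwise λ n → ℚ.*-distribˡ-+ (seq x n) (seq y n) (seq z n)

    *-distribʳ-+ : ∀ x y z → ((y + z) * x) ≃ ((y * x) + (z * x))
    *-distribʳ-+ x y z = pointwise λ n → ℚ.*-distribʳ-+ (seq x n) (seq y n) (seq z n)

    *-comm : ∀ x y → (x * y) ≃ (y * x)
    *-comm x y = pointwise λ n → ℚ.*-comm (seq x n) (seq y n)

    isCommutativeRing : IsCommutativeRing _≃_ _+_ _*_ -_ (fromℚ 0ℚ) (fromℚ 1ℚ)
    isCommutativeRing = record
      { isRing = record
        { +-isAbelianGroup = record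
          { isGroup = record
            { isMonoid = record
              { isSemigroup = record
                { isMagma = record { isEquivalence = ≃-isEquivalence ; ∙-cong = +-cong }
                ; assoc   = +-assoc
                }
              ; identity = +-identityˡ , +-identityʳ
              }
            ; inverse = +-inverseˡ , +-inverseʳ
            ; ⁻¹-cong = -‿cong
            }
          ; comm = +-comm
          }
        ; *-cong     = *-cong
        ; *-assoc    = *-assoc
        ; *-identity = *-identityˡ , *-identityʳ
        ; distrib    = *-distribˡ-+ , *-distribʳ-+
        }
      ; *-comm = *-comm
      }

  ℝ-commutativeRing : CommutativeRing 0ℓ 0ℓ
  ℝ-commutativeRing = record { isCommutativeRing = isCommutativeRing }

open RealNumbers public using (ℝ-commutativeRing)

------------------------------------------------------------------------
-- Complex numbers

record ℂ : Set where
  no-eta-equality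
  field re im : ℝ
open ℂ public

infix 4 _≃ᶜ_
record _≃ᶜ_ (z w : ℂ) : Set where
  constructor _,_
  field
    re≃ : re z ≃ re w
    im≃ : im z ≃ im w

module ComplexNumbers where
  open RealNumbers using (pointwise)

  private
    module ℝ′ = CommutativeRing ℝ-commutativeRing

  fromℝ : ℝ → ℂ
  re (fromℝ x) = x
  im (fromℝ x) = ℝ′.0#

  0ℂ 1ℂ : ℂ
  0ℂ = fromℝ ℝ′.0#
  1ℂ = fromℝ ℝ′.1#

  _+_ : ℂ → ℂ → ℂ
  re (z + w) = re z ℝ′.+ re w
  im (z + w) = im z ℝ′.+ im w

  -_ : ℂ → ℂ
  re (- z) = ℝ′.- re z
  im (- z) = ℝ′.- im z

  _*_ : ℂ → ℂ → ℂ
  re (z * w) = re z ℝ′.* re w ℝ′.- im z ℝ′.* im w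
  im (z * w) = re z ℝ′.* im w ℝ′.+ im z ℝ′.* re w

  private
    ≃ᶜ-isEquivalence : IsEquivalence _≃ᶜ_
    ≃ᶜ-isEquivalence = record
      { refl  = ℝ′.refl , ℝ′.refl
      ; sym   = λ (e , f) → ℝ′.sym e , ℝ′.sym f
      ; trans = λ (e , f) (g , h) → ℝ′.trans e g , ℝ′.trans f h
      }
    open IsEquivalence ≃ᶜ-isEquivalence renaming (trans to ≃ᶜ-trans) using ()

    +-cong : ∀ {z w u v} → z ≃ᶜ w → u ≃ᶜ v → (z + u) ≃ᶜ (w + v)
    +-cong (e , f) (g , h) = ℝ′.+-cong e g , ℝ′.+-cong f h

    *-cong : ∀ {z w u v} → z ≃ᶜ w → u ≃ᶜ v → (z * u) ≃ᶜ (w * v)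
    *-cong (e , f) (g , h) =
      ℝ′.+-cong (ℝ′.*-cong e g) (ℝ′.-‿cong (ℝ′.*-cong f h)) ,
      ℝ′.+-cong (ℝ′.*-cong e h) (ℝ′.*-cong f g)

    *-comm : ∀ z w → (z * w) ≃ᶜ (w * z)
    *-comm z w =
      pointwise (λ n → re-law (seq (re z) n) (seq (im z) n) (seq (re w) n) (seq (im w) n)) ,
      pointwise (λ n → im-law (seq (re z) n) (seq (im z) n) (seq (re w) n) (seq (im w) n))
      where
      re-law : ∀ a b c d → a ℚ.* c ℚ.- b ℚ.* d ≡ c ℚ.* a ℚ.- d ℚ.* b
      re-law = solve-∀ ℚ-solverRing
      im-law : ∀ a b c d → a ℚ.* d ℚ.+ b ℚ.* c ≡ c ℚ.* b ℚ.+ d ℚ.* a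
      im-law = solve-∀ ℚ-solverRing

    *-identityˡ : ∀ z → (1ℂ * z) ≃ᶜ z
    *-identityˡ z =
      pointwise (λ n → re-law (seq (re z) n) (seq (im z) n)) ,
      pointwise (λ n → im-law (seq (re z) n) (seq (im z) n))
      where
      re-law : ∀ a b → 1ℚ ℚ.* a ℚ.- 0ℚ ℚ.* b ≡ a
      re-law = solve-∀ ℚ-solverRing
      im-law : ∀ a b → 1ℚ ℚ.* b ℚ.+ 0ℚ ℚ.* a ≡ b
      im-law = solve-∀ ℚ-solverRing

    *-assoc : ∀ z w u → ((z * w) * u) ≃ᶜ (z * (w * u))
    *-assoc z w u =
      pointwise (λ n → re-law (seq (re z) n) (seq (im z) n) (seq (re w) n) (seq (im w) n) (seq (re u) n) (seq (im u) n)) ,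
      pointwise (λ n → im-law (seq (re z) n) (seq (im z) n) (seq (re w) n) (seq (im w) n) (seq (re u) n) (seq (im u) n))
      where
      re-law : ∀ a b c d e f →
        (a ℚ.* c ℚ.- b ℚ.* d) ℚ.* e ℚ.- (a ℚ.* d ℚ.+ b ℚ.* c) ℚ.* f ≡
        a ℚ.* (c ℚ.* e ℚ.- d ℚ.* f) ℚ.- b ℚ.* (c ℚ.* f ℚ.+ d ℚ.* e)
      re-law = solve-∀ ℚ-solverRing
      im-law : ∀ a b c d e f →
        (a ℚ.* c ℚ.- b ℚ.* d) ℚ.* f ℚ.+ (a ℚ.* d ℚ.+ b ℚ.* c) ℚ.* e ≡
        a ℚ.* (c ℚ.* f ℚ.+ d ℚ.* e) ℚ.+ b ℚ.* (c ℚ.* e ℚ.- d ℚ.* f)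
      im-law = solve-∀ ℚ-solverRing

    distribˡ : ∀ z w u → (z * (w + u)) ≃ᶜ ((z * w) + (z * u))
    distribˡ z w u =
      pointwise (λ n → re-law (seq (re z) n) (seq (im z) n) (seq (re w) n) (seq (im w) n) (seq (re u) n) (seq (im u) n)) ,
      pointwise (λ n → im-law (seq (re z) n) (seq (im z) n) (seq (re w) n) (seq (im w) n) (seq (re u) n) (seq (im u) n))
      where
      re-law : ∀ a b c d e f →
        a ℚ.* (c ℚ.+ e) ℚ.- b ℚ.* (d ℚ.+ f) ≡
        (a ℚ.* c ℚ.- b ℚ.* d) ℚ.+ (a ℚ.* e ℚ.- b ℚ.* f)
      re-law = solve-∀ ℚ-solverRing
      im-law : ∀ a b c d e f →
        a ℚ.* (d ℚ.+ f) ℚ.+ b ℚ.* (c ℚ.+ e) ≡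
        (a ℚ.* d ℚ.+ b ℚ.* c) ℚ.+ (a ℚ.* f ℚ.+ b ℚ.* e)
      im-law = solve-∀ ℚ-solverRing

    distribʳ : ∀ z w u → ((w + u) * z) ≃ᶜ ((w * z) + (u * z))
    distribʳ z w u = ≃ᶜ-trans (*-comm (w + u) z)
      (≃ᶜ-trans (distribˡ z w u) (+-cong (*-comm z w) (*-comm z u)))

    isCommutativeRing : IsCommutativeRing _≃ᶜ_ _+_ _*_ -_ 0ℂ 1ℂ
    isCommutativeRing = record
      { isRing = record
        { +-isAbelianGroup = record
          { isGroup = record
            { isMonoid = record
              { isSemigroup = record
                { isMagma = record { isEquivalence = ≃ᶜ-isEquivalence ; ∙-cong = +-cong }
                ; assoc   = λ z w u → ℝ′.+-assoc (re z) (re w) (re u)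
                                    , ℝ′.+-assoc (im z) (im w) (im u)
                }
              ; identity = (λ z → ℝ′.+-identityˡ (re z) , ℝ′.+-identityˡ (im z))
                         , (λ z → ℝ′.+-identityʳ (re z) , ℝ′.+-identityʳ (im z))
              }
            ; inverse = (λ z → ℝ′.-‿inverseˡ (re z) , ℝ′.-‿inverseˡ (im z))
                      , (λ z → ℝ′.-‿inverseʳ (re z) , ℝ′.-‿inverseʳ (im z))
            ; ⁻¹-cong = λ (e , f) → ℝ′.-‿cong e , ℝ′.-‿cong f
            }
          ; comm = λ z w → ℝ′.+-comm (re z) (re w) , ℝ′.+-comm (im z) (im w)
          }
        ; *-cong     = *-cong
        ; *-assoc    = *-assoc
        ; *-identity = *-identityˡ , λ z → ≃ᶜ-trans (*-comm z 1ℂ) (*-identityˡ z)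
        ; distrib    = distribˡ , distribʳ
        }
      ; *-comm = *-comm
      }

  ℂ-commutativeRing : CommutativeRing 0ℓ 0ℓ
  ℂ-commutativeRing = record { isCommutativeRing = isCommutativeRing }

open ComplexNumbers public using (ℂ-commutativeRing)

------------------------------------------------------------------------
-- Notation for arithmetic in ℂ, ℤ[x] and ℂ[x]

module ℂ-Arithmetic where
  open CommutativeRing ℂ-commutativeRing public using (_≈_; _*_; -_; 1#)
  open Exp (CommutativeRing.semiring ℂ-commutativeRing) public using (_^_)

  root-of-minus-one-invertible :
    ∀ {k} → 1 ℕ.≤ k → ∀ η → η ^ k ≈ - 1# → ∃[ η⁻¹ ] (η * η⁻¹ ≈ 1#)
  root-of-minus-one-invertible {suc k} _ η ηᵏ≈-1 = - (η ^ k) , (begin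
    η * - (η ^ k) ≈⟨ -‿distribʳ-* η (η ^ k) ⟨
    - (η * η ^ k) ≈⟨ -‿cong ηᵏ≈-1 ⟩
    - (- 1#)      ≈⟨ -‿involutive 1# ⟩
    1#            ∎)
    where
    open CommutativeRing ℂ-commutativeRing using (ring; -‿cong; setoid)
    open RingProperties ring using (-‿distribʳ-*; -‿involutive)
    open SetoidReasoning setoid

module PolynomialArithmetic (R : CommutativeRing c ℓ) where
  open Polynomial R public using (polynomialRing; const) renaming (X to x)
  open CommutativeRing polynomialRing public using (_≈_; _+_; _-_; _*_; -_; 0#; 1#)
  open PolymatroidPolynomials polynomialRing public using (_^_; T; χ)

module ℤ[x] = PolynomialArithmetic ℤ.+-*-commutativeRing
module ℂ[x] = PolynomialArithmetic ℂ-commutativeRing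

-- Put w = y − 1 and let w⁻¹ be its inverse. In both cases w ^ k = −1 and x − 1 = t w⁻¹, where t is
-- the argument of χ. Since r(P) = (r(P) − r(A)) + r(A), multiplying the term of T_k at A by w ^ r(P)
-- turns (t w⁻¹) ^ (r(P) − r(A)) into t ^ (r(P) − r(A)) and completes w ^ (k|A| − r(A)) to
-- w ^ (k|A|) = (−1) ^ |A|. That k|A| − r(A) is a genuine exponent follows from subadditivity of r.

module Submission where

open import Defs
open import Algebra.Bundles using (CommutativeRing)
import Algebra.Properties.AbelianGroup as AbelianGroupProperties
import Algebra.Properties.CommutativeSemigroup as CommutativeSemigroupProperties
import Algebra.Properties.CommutativeSemiring.Exp as CommutativeExp
import Algebra.Properties.Group as GroupProperties
import Algebra.Properties.Ring as RingProperties
import Algebra.Properties.Semiring.Exp as Exp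
open import Data.Fin.Subset using (Subset; inside; outside; ⊥; ⊤; _∪_; _∩_; ⁅_⁆) renaming (∣_∣ to card)
open import Data.Fin.Subset.Properties using (∪-identityˡ; ⊆-max)
open import Data.Fin.Base using (zero; suc)
open import Data.Integer.Base as ℤ using (ℤ; 0ℤ)
import Data.Integer.Properties as ℤ
open import Data.Nat.Base as ℕ using (ℕ; zero; suc; _≤_)
open import Data.Nat.Divisibility
  using (_∣_; _∤_; _∣?_; _∣0; ∣-refl; ∣m∣n⇒∣m+n; ∣m+n∣m⇒∣n)
import Data.Nat.Properties as ℕ
open import Data.Product.Base using (_×_; _,_)
open import Data.Vec.Base using (_∷_; [])
open import Level using (Level)
open import Relation.Binary.PropositionalEquality as ≡ using (_≡_; cong; cong₂)
import Relation.Binary.Reasoning.Setoid as SetoidReasoning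
open import Relation.Nullary.Decidable using (from-no)
open import Relation.Nullary.Negation using (contradiction)

private variable
  c ℓ : Level
  n : ℕ

-- Stated for arbitrary subadditive `f` so that the induction on the ground set can pass to `f`
-- restricted to the subsets avoiding the first element. That restriction inherits all three
-- hypotheses, and each element put back costs at most `k`.
subadditive⇒≤k*card : ∀ {n} k (f : Subset n → ℤ) → f ⊥ ≡ 0ℤ →
  (∀ A B → f (A ∪ B) ℤ.≤ f A ℤ.+ f B) → (∀ e → f ⁅ e ⁆ ℤ.≤ ℤ.+ k) →
  ∀ A → f A ℤ.≤ ℤ.+ (k ℕ.* card A)
subadditive⇒≤k*card k f f⊥≡0 sub bound [] =
  ℤ.≤-trans (ℤ.≤-reflexive f⊥≡0) (ℤ.+≤+ ℕ.z≤n)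
subadditive⇒≤k*card k f f⊥≡0 sub bound (outside ∷ A) =
  subadditive⇒≤k*card k (λ B → f (outside ∷ B)) f⊥≡0
    (λ B C → sub (outside ∷ B) (outside ∷ C)) (λ e → bound (suc e)) A
subadditive⇒≤k*card k f f⊥≡0 sub bound (inside ∷ A) = begin
  -- `⁅ zero ⁆` is `inside ∷ ⊥`, so its union with `outside ∷ A` computes to `inside ∷ (⊥ ∪ A)`.
  f (inside ∷ A)                     ≡⟨ cong (λ B → f (inside ∷ B)) (∪-identityˡ A) ⟨
  f (⁅ zero ⁆ ∪ (outside ∷ A))       ≤⟨ sub ⁅ zero ⁆ (outside ∷ A) ⟩
  f ⁅ zero ⁆ ℤ.+ f (outside ∷ A)     ≤⟨ ℤ.+-mono-≤ (bound zero)
                                          (subadditive⇒≤k*card k (λ B → f (outside ∷ B)) f⊥≡0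
                                            (λ B C → sub (outside ∷ B) (outside ∷ C))
                                            (λ e → bound (suc e)) A) ⟩
  ℤ.+ (k ℕ.+ k ℕ.* card A)           ≡⟨ cong ℤ.+_ (ℕ.*-suc k (card A)) ⟨
  ℤ.+ (k ℕ.* card (inside ∷ A))      ∎
  where open ℤ.≤-Reasoning

-- The two bounds make all three absolute values exact, so the cancellation `(i - j) + j = i` in the
-- integers descends to the natural-number exponents.
∣i-j∣+∣j∣≡∣i∣ : ∀ {i j} → 0ℤ ℤ.≤ j → j ℤ.≤ i → ℤ.∣ i ℤ.- j ∣ ℕ.+ ℤ.∣ j ∣ ≡ ℤ.∣ i ∣
∣i-j∣+∣j∣≡∣i∣ {i} {j} 0≤j j≤i = ℤ.+-injective (begin
  ℤ.+ ℤ.∣ i ℤ.- j ∣ ℤ.+ ℤ.+ ℤ.∣ j ∣ ≡⟨ cong₂ ℤ._+_ (ℤ.0≤i⇒+∣i∣≡i (ℤ.i≤j⇒0≤j-i j≤i))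
                                                   (ℤ.0≤i⇒+∣i∣≡i 0≤j) ⟩
  (i ℤ.- j) ℤ.+ j                   ≡⟨ //-rightDividesˡ j i ⟩
  i                                 ≡⟨ ℤ.0≤i⇒+∣i∣≡i (ℤ.≤-trans 0≤j j≤i) ⟨
  ℤ.+ ℤ.∣ i ∣                       ∎)
  where
  open ≡.≡-Reasoning
  open GroupProperties (CommutativeRing.+-group ℤ.+-*-commutativeRing) using (//-rightDividesˡ)

module _ (P : Polymatroid n) where
  open Polymatroid P

  subadditive : ∀ A B → r (A ∪ B) ℤ.≤ r A ℤ.+ r B
  subadditive A B = begin
    r (A ∪ B)                ≡⟨ ℤ.+-identityʳ (r (A ∪ B)) ⟨
    r (A ∪ B) ℤ.+ 0ℤ         ≤⟨ ℤ.+-monoʳ-≤ (r (A ∪ B)) (0≤r P (A ∩ B)) ⟩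
    r (A ∪ B) ℤ.+ r (A ∩ B)  ≤⟨ submodular A B ⟩
    r A ℤ.+ r B              ∎
    where open ℤ.≤-Reasoning

  r≤k*card : ∀ {k} → Is k -Polymatroid P → ∀ A → r A ℤ.≤ ℤ.+ (k ℕ.* card A)
  r≤k*card {k} = subadditive⇒≤k*card k r r-∅ subadditive

  corank+∣r∣ : ∀ A → corank P A ℕ.+ ℤ.∣ r A ∣ ≡ totalRank P
  corank+∣r∣ A = ∣i-j∣+∣j∣≡∣i∣ (0≤r P A) (monotone A ⊤ (⊆-max A))

  -- The `k`-polymatroid bound enters here: it gives `r A ≤ k * card A`, so the absolute value in
  -- `nullity` loses no sign.
  nullity+∣r∣ : ∀ {k} → Is k -Polymatroid P → ∀ A → nullity k P A ℕ.+ ℤ.∣ r A ∣ ≡ k ℕ.* card A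
  nullity+∣r∣ isK A = ∣i-j∣+∣j∣≡∣i∣ (0≤r P A) (r≤k*card isK A)

module EvaluationIdentity (R : CommutativeRing c ℓ) where
  open CommutativeRing R
  open PolymatroidPolynomials R
  open Exp semiring using (^-congˡ; ^-congʳ; ^-homo-*; ^-assocʳ)
  open CommutativeExp commutativeSemiring using (^-distrib-*)
  open CommutativeSemigroupProperties *-commutativeSemigroup using (x∙yz≈y∙xz; interchange)
  open RingProperties ring using (-‿distribˡ-*; -‿distribʳ-*; -‿involutive)
  open SetoidReasoning setoid

  ∑⊆-cong : ∀ {n} {f g : Subset n → Carrier} → (∀ A → f A ≈ g A) → ∑⊆ f ≈ ∑⊆ g
  ∑⊆-cong {zero}  f≈g = f≈g []
  ∑⊆-cong {suc n} f≈g =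
    +-cong (∑⊆-cong λ A → f≈g (outside ∷ A)) (∑⊆-cong λ A → f≈g (inside ∷ A))

  *-distribˡ-∑⊆ : ∀ {n} a (f : Subset n → Carrier) → a * ∑⊆ f ≈ ∑⊆ (λ A → a * f A)
  *-distribˡ-∑⊆ {zero}  a f = refl
  *-distribˡ-∑⊆ {suc n} a f = trans (distribˡ a _ _)
    (+-cong (*-distribˡ-∑⊆ a (λ A → f (outside ∷ A))) (*-distribˡ-∑⊆ a (λ A → f (inside ∷ A))))

  1^n≈1 : ∀ n → 1# ^ n ≈ 1#
  1^n≈1 zero    = refl
  1^n≈1 (suc n) = trans (*-identityˡ _) (1^n≈1 n)

  inverse-^ : ∀ {w w⁻¹} → w * w⁻¹ ≈ 1# → ∀ m → w ^ m * w⁻¹ ^ m ≈ 1#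
  inverse-^ {w} {w⁻¹} ww⁻¹≈1 m = begin
    w ^ m * w⁻¹ ^ m ≈⟨ ^-distrib-* w w⁻¹ m ⟨
    (w * w⁻¹) ^ m   ≈⟨ ^-congˡ m ww⁻¹≈1 ⟩
    1# ^ m          ≈⟨ 1^n≈1 m ⟩
    1#              ∎

  neg-*-neg : ∀ a b → - a * - b ≈ a * b
  neg-*-neg a b = begin
    - a * - b   ≈⟨ -‿distribˡ-* a (- b) ⟨
    - (a * - b) ≈⟨ -‿cong (-‿distribʳ-* a b) ⟨
    - - (a * b) ≈⟨ -‿involutive (a * b) ⟩
    a * b       ∎

  neg-*-neg-* : ∀ a b → - a * (- a * b) ≈ a * (a * b)
  neg-*-neg-* a b = begin
    - a * (- a * b) ≈⟨ *-assoc (- a) (- a) b ⟨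
    (- a * - a) * b ≈⟨ *-congʳ (neg-*-neg a a) ⟩
    (a * a) * b     ≈⟨ *-assoc a a b ⟩
    a * (a * b)     ∎

  -- Factors are removed in pairs, whose signs cancel, and `2 ∣ 2 + k` descends to `2 ∣ k`.
  neg-^-even : ∀ k → 2 ∣ k → ∀ a → (- a) ^ k ≈ a ^ k
  neg-^-even zero          2∣k a = refl
  neg-^-even (suc zero)    2∣k a = contradiction 2∣k (from-no (2 ∣? 1))
  neg-^-even (suc (suc k)) 2∣k a = trans
    (*-congˡ (*-congˡ (neg-^-even k (∣m+n∣m⇒∣n 2∣k ∣-refl) a))) (neg-*-neg-* a (a ^ k))

  -1^odd : ∀ k → 2 ∤ k → (- 1#) ^ k ≈ - 1#
  -1^odd zero          2∤k = contradiction (2 ∣0) 2∤k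
  -1^odd (suc zero)    2∤k = *-identityʳ (- 1#)
  -1^odd (suc (suc k)) 2∤k = begin
    - 1# * (- 1# * (- 1#) ^ k) ≈⟨ neg-*-neg-* 1# _ ⟩
    1# * (1# * (- 1#) ^ k)     ≈⟨ trans (*-identityˡ _) (*-identityˡ _) ⟩
    (- 1#) ^ k                 ≈⟨ -1^odd k (λ 2∣k → 2∤k (∣m∣n⇒∣m+n ∣-refl 2∣k)) ⟩
    - 1#                       ∎

  -- The common form of both parity cases. The factor `w ^ totalRank P` does not depend on `A`, so
  -- it moves inside the sum and the two sides agree term by term. The inverse of `w` is given as a
  -- witness because the ring is arbitrary.
  T≈χ : ∀ {k} (P : Polymatroid n) → Is k -Polymatroid P → ∀ {x y t w w⁻¹} →
    w * w⁻¹ ≈ 1# → w ^ k ≈ - 1# → x - 1# ≈ t * w⁻¹ → y - 1# ≈ w →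
    w ^ totalRank P * T k P x y ≈ χ P t
  T≈χ {n} {k} P isK {x} {y} {t} {w} {w⁻¹} ww⁻¹≈1 wᵏ≈-1 x-1≈tw⁻¹ y-1≈w =
    trans (*-distribˡ-∑⊆ {n} _ _) (∑⊆-cong term)
    where
    term : ∀ A → w ^ totalRank P * ((x - 1#) ^ corank P A * (y - 1#) ^ nullity k P A) ≈
                 (- 1#) ^ card A * t ^ corank P A
    term A = begin
      w ^ totalRank P * ((x - 1#) ^ d * (y - 1#) ^ e)
        ≈⟨ *-cong wʳ (*-cong tᵈ (^-congˡ e y-1≈w)) ⟩
      (w ^ d * w ^ s) * ((t ^ d * w⁻¹ ^ d) * w ^ e)
        ≈⟨ *-congˡ (*-assoc _ _ _) ⟩
      (w ^ d * w ^ s) * (t ^ d * (w⁻¹ ^ d * w ^ e))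
        ≈⟨ x∙yz≈y∙xz _ _ _ ⟩
      t ^ d * ((w ^ d * w ^ s) * (w⁻¹ ^ d * w ^ e))
        -- Pairs `w ^ d` with the matching power of the inverse, and `w ^ s` with `w ^ e`.
        ≈⟨ *-congˡ (interchange _ _ _ _) ⟩
      t ^ d * ((w ^ d * w⁻¹ ^ d) * (w ^ s * w ^ e))
        ≈⟨ *-congˡ (*-cong (inverse-^ ww⁻¹≈1 d) (*-comm _ _)) ⟩
      t ^ d * (1# * (w ^ e * w ^ s))
        ≈⟨ *-congˡ (trans (*-identityˡ _) wᵉ⁺ˢ) ⟩
      t ^ d * (- 1#) ^ card A
        ≈⟨ *-comm _ _ ⟩
      (- 1#) ^ card A * t ^ d ∎
      where
      d e s : ℕ
      d = corank P A
      e = nullity k P A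
      s = ℤ.∣ Polymatroid.r P A ∣

      wʳ : w ^ totalRank P ≈ w ^ d * w ^ s
      wʳ = trans (^-congʳ w (≡.sym (corank+∣r∣ P A))) (^-homo-* w d s)

      tᵈ : (x - 1#) ^ d ≈ t ^ d * w⁻¹ ^ d
      tᵈ = trans (^-congˡ d x-1≈tw⁻¹) (^-distrib-* t w⁻¹ d)

      wᵉ⁺ˢ : w ^ e * w ^ s ≈ (- 1#) ^ card A
      wᵉ⁺ˢ = begin
        w ^ e * w ^ s      ≈⟨ ^-homo-* w e s ⟨
        w ^ (e ℕ.+ s)      ≈⟨ ^-congʳ w (nullity+∣r∣ P isK A) ⟩
        w ^ (k ℕ.* card A) ≈⟨ ^-assocʳ w k (card A) ⟨
        (w ^ k) ^ card A   ≈⟨ ^-congˡ (card A) wᵏ≈-1 ⟩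
        (- 1#) ^ card A    ∎

  -- The case where `w` and its inverse are both `- 1#` and `t` is `- x`; oddness of `k` gives
  -- `w ^ k ≈ - 1#`.
  T-odd : ∀ {k} (P : Polymatroid n) → Is k -Polymatroid P → 2 ∤ k → ∀ x →
    (- 1#) ^ totalRank P * T k P (x + 1#) 0# ≈ χ P (- x)
  T-odd {k = k} P isK 2∤k x = T≈χ P isK
    (trans (neg-*-neg 1# 1#) (*-identityˡ 1#))
    (-1^odd k 2∤k)
    (trans (//-rightDividesʳ 1# x) (sym (trans (neg-*-neg x 1#) (*-identityʳ x))))
    (+-identityˡ (- 1#))
    where open GroupProperties +-group using (//-rightDividesʳ)

  -- The case where `w` is `- η`, its inverse is `- η⁻¹` and `t` is `- x`. The signs in `t * w⁻¹`
  -- cancel, and evenness of `k` removes the sign from `(- η) ^ k`.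
  T-even : ∀ {k} (P : Polymatroid n) → Is k -Polymatroid P → 2 ∣ k → ∀ x η η⁻¹ →
    η ^ k ≈ - 1# → η * η⁻¹ ≈ 1# →
    (- η) ^ totalRank P * T k P (1# + x * η⁻¹) (1# - η) ≈ χ P (- x)
  T-even {k = k} P isK 2∣k x η η⁻¹ ηᵏ≈-1 ηη⁻¹≈1 = T≈χ P isK
    (trans (neg-*-neg η η⁻¹) ηη⁻¹≈1)
    (trans (neg-^-even k 2∣k η) ηᵏ≈-1)
    (trans (xyx⁻¹≈y 1# _) (sym (neg-*-neg x η⁻¹)))
    (xyx⁻¹≈y 1# (- η))
    where open AbelianGroupProperties +-abelianGroup using (xyx⁻¹≈y)

module ConstantPolynomials (R : CommutativeRing c ℓ) where
  open Polynomial R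
  private
    module R = CommutativeRing R
    module Q = CommutativeRing polynomialRing
  open Exp R.semiring using () renaming (_^_ to _^ᴿ_)
  open Exp Q.semiring using () renaming (_^_ to _^ᴾ_)

  const-cong : ∀ {a b} → a R.≈ b → const a ≋ const b
  const-cong a≈b = mk≋ λ { zero → a≈b ; (suc i) → R.refl }

  const-* : ∀ a b → const a ⊛ const b ≋ const (a R.* b)
  -- The shifted tail in `⊛` adds a `0#` to the constant coefficient.
  const-* a b = const-cong (R.+-identityʳ (a R.* b))

  -- Carries the equation for `η ^ k` from the complex numbers to the polynomials over them.
  const-^ : ∀ a m → const a ^ᴾ m ≋ const (a ^ᴿ m)
  const-^ a zero    = Q.refl
  const-^ a (suc m) = Q.trans (Q.*-congˡ {const a} (const-^ a m)) (const-* a (a ^ᴿ m))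

proposition3p6 : ∀ {n : ℕ} (k : ℕ) → 1 ≤ k → (P : Polymatroid n) → Is k -Polymatroid P →
    (2 ∤ k →
    let open ℤ[x] in
    (- 1#) ^ totalRank P * T k P (x + 1#) 0# ≈ χ P (- x))
    ×
    (2 ∣ k → (η η⁻¹ : ℂ) →
    (let open ℂ-Arithmetic in η ^ k ≈ - 1#) →
    (let open ℂ-Arithmetic in η * η⁻¹ ≈ 1#) →
    let open ℂ[x] in
    (- const η) ^ totalRank P * T k P (1# + x * const η⁻¹) (1# - const η) ≈ χ P (- x))
proposition3p6 k _ P isK =
  -- The identities hold at every ring element; evaluating at the indeterminate gives identities of
  -- polynomials.
  (λ 2∤k → EvaluationIdentity.T-odd ℤ[x].polynomialRing P isK 2∤k ℤ[x].x) ,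
  (λ 2∣k η η⁻¹ ηᵏ≈-1 ηη⁻¹≈1 →
    EvaluationIdentity.T-even ℂ[x].polynomialRing P isK 2∣k ℂ[x].x (const η) (const η⁻¹)
      -- The polynomials `- 1#` and `1#` compute to `const` of the corresponding complex numbers, so
      -- the two equations for `η` transfer directly.
      (trans (const-^ η k) (const-cong ηᵏ≈-1))
      (trans (const-* η η⁻¹) (const-cong ηη⁻¹≈1)))
  where
  open ℂ[x] using (const)
  open ConstantPolynomials ℂ-commutativeRing
  open CommutativeRing ℂ[x].polynomialRing using (trans)
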